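{- For every integer $n\ge 0$, $$\sum_{k=0}^{n}(-1)^{n-k}\det\begin{pmatrix} M_{n,k}(0,0) & M_{n,k+1}(0,0)\\ M_{n+1,k}(0,0) & M_{n+1,k+1}(0,0)\end{pmatrix}=C_{n+1};$$ or equivalently (the cases $n=2m$ and $n=2m+1$ respectively), for every integer $m\ge 0$, $$C_{2m+1}=\sum_{j=0}^{m}\frac{(2j+2)^2}{(2m+2)^2}\binom{2m+2}{m-j}^2,$$ $$C_{2m+2}=\sum_{j=0}^{m}\frac{(2j+2)^2}{(2m+2)(2m+3)}\binom{2m+3}{m-j}\binom{2m+3}{m-j+1}.$$
   Context: $C_n=\frac{1}{n+1}\binom{2n}{n}$ is the $n$-th Catalan number. A partial Motzkin path from $(0,0)$ to $(n,k)$ is a lattice path that never goes below the $X$-axis and consists of up steps $U=(1,1)$, down steps $D=(1,-1)$ and horizontal steps $H=(1,0)$. Every up step and every down step has weight $1$, every horizontal step lying on the $X$-axis has weight $x$, and every horizontal step not lying on the $X$-axis has weight $y$; the weight of a path is the product of the weights of its steps. $M_{n,k}(x,y)$ is the sum of the weights of all partial Motzkin paths from $(0,0)$ to $(n,k)$. Equivalently, $M_{0,0}(x,y)=1$, $M_{n,k}(x,y)=0$ if $n<k$ or $k<0$, $M_{n,0}(x,y)=xM_{n-1,0}(x,y)+M_{n-1,1}(x,y)$ for $n\ge1$, and $M_{n,k}(x,y)=M_{n-1,k-1}(x,y)+yM_{n-1,k}(x,y)+M_{n-1,k+1}(x,y)$ for $n\ge k\ge 1$. $M_{n,k}(0,0)$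 is the value at $x=y=0$. -}

module Defs where

open import Data.Integer.Base as ℤ using (ℤ; +_; 1ℤ; 0ℤ)
open import Data.List.Base using (List; []; _∷_; _++_; map; foldr)
open import Data.List.Membership.Propositional using (_∈_)
open import Data.List.Membership.Propositional.Properties
  using (∈-map⁺; ∈-map⁻; ∈-++⁺ˡ; ∈-++⁺ʳ; ∈-++⁻)
open import Data.List.Relation.Unary.All using ([])
open import Data.List.Relation.Unary.Any using (here)
open import Data.List.Relation.Unary.Unique.Propositional using (Unique; []; _∷_)
open import Data.List.Relation.Unary.Unique.Propositional.Properties
  using (map⁺; ++⁺)
open import Data.List.Relation.Binary.Disjoint.Propositional using (Disjoint)
open import Data.Nat.Base using (ℕ; zero; suc; _*_)
open import Data.Nat.Combinatorics using (_C_)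
open import Data.Product.Base using (_,_)
open import Data.Sum.Base using (inj₁; inj₂)
open import Relation.Nullary.Negation.Core using (¬_)
open import Data.Rational.Base as ℚ using (ℚ; _/_)
open import Relation.Binary.PropositionalEquality.Core using (_≡_; refl; sym; trans)

-- `Path n k` is the type of partial Motzkin paths from (0,0) to (n,k), built
-- up by appending a last step.  Heights are natural numbers, so a path cannot
-- go below the X-axis: a down step must start at positive height.
infixl 5 _▷U _▷D _▷H

data Path : ℕ → ℕ → Set where
  origin : Path 0 0
  _▷U    : ∀ {n k} → Path n k       → Path (suc n) (suc k)
  _▷D    : ∀ {n k} → Path n (suc k) → Path (suc n) k
  _▷H    : ∀ {n k} → Path n k       → Path (suc n) k

horizontalWeight : (x y : ℤ) (height : ℕ) → ℤ
horizontalWeight x y zero    = x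
horizontalWeight x y (suc _) = y

weight : (x y : ℤ) → ∀ {n k} → Path n k → ℤ
weight x y origin = 1ℤ
weight x y (p ▷U) = weight x y p ℤ.* 1ℤ
weight x y (p ▷D) = weight x y p ℤ.* 1ℤ
weight x y (_▷H {k = k} p) = weight x y p ℤ.* horizontalWeight x y k

paths : ∀ n k → List (Path n k)
paths zero    zero    = origin ∷ []
paths zero    (suc k) = []
paths (suc n) zero    = map _▷H (paths n 0) ++ map _▷D (paths n 1)
paths (suc n) (suc k) =
  map _▷U (paths n k) ++ map _▷H (paths n (suc k)) ++ map _▷D (paths n (suc (suc k)))

-- `paths n k` lists every path from (0,0) to (n,k) exactly once.
paths-complete : ∀ {n k} (p : Path n k) → p ∈ paths n k
paths-complete origin = here refl
paths-complete (p ▷U) = ∈-++⁺ˡ (∈-map⁺ _▷U (paths-complete p))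
paths-complete (_▷D {n} {zero}  p) =
  ∈-++⁺ʳ (map _▷H (paths n 0)) (∈-map⁺ _▷D (paths-complete p))
paths-complete (_▷D {n} {suc k} p) =
  ∈-++⁺ʳ (map _▷U (paths n k))
    (∈-++⁺ʳ (map _▷H (paths n (suc k))) (∈-map⁺ _▷D (paths-complete p)))
paths-complete (_▷H {n} {zero}  p) = ∈-++⁺ˡ (∈-map⁺ _▷H (paths-complete p))
paths-complete (_▷H {n} {suc k} p) =
  ∈-++⁺ʳ (map _▷U (paths n k)) (∈-++⁺ˡ (∈-map⁺ _▷H (paths-complete p)))

private
  map-disjoint : ∀ {A B C : Set} {f : A → C} {g : B → C} →
                 (∀ a b → ¬ f a ≡ g b) →
                 ∀ {xs ys} → Disjoint (map f xs) (map g ys)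
  map-disjoint f≢g (v∈fxs , v∈gys) with ∈-map⁻ _ v∈fxs | ∈-map⁻ _ v∈gys
  ... | a , _ , v≡fa | b , _ , v≡gb = f≢g a b (trans (sym v≡fa) v≡gb)

  disjoint-++ : ∀ {A : Set} {xs ys zs : List A} →
                Disjoint xs ys → Disjoint xs zs → Disjoint xs (ys ++ zs)
  disjoint-++ {ys = ys} xs#ys xs#zs (v∈xs , v∈ys++zs) with ∈-++⁻ ys v∈ys++zs
  ... | inj₁ v∈ys = xs#ys (v∈xs , v∈ys)
  ... | inj₂ v∈zs = xs#zs (v∈xs , v∈zs)

paths-unique : ∀ n k → Unique (paths n k)
paths-unique zero    zero    = [] ∷ []
paths-unique zero    (suc k) = []
paths-unique (suc n) zero    =
  ++⁺ (map⁺ (λ { refl → refl }) (paths-unique n 0))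
      (map⁺ (λ { refl → refl }) (paths-unique n 1))
      (map-disjoint λ _ _ ())
paths-unique (suc n) (suc k) =
  ++⁺ (map⁺ (λ { refl → refl }) (paths-unique n k))
      (++⁺ (map⁺ (λ { refl → refl }) (paths-unique n (suc k)))
           (map⁺ (λ { refl → refl }) (paths-unique n (suc (suc k))))
           (map-disjoint λ _ _ ()))
      (disjoint-++ {ys = map _▷H (paths n (suc k))}
        (map-disjoint λ _ _ ()) (map-disjoint λ _ _ ()))

M : (n k : ℕ) (x y : ℤ) → ℤ
M n k x y = foldr ℤ._+_ 0ℤ (map (weight x y) (paths n k))

det₂ : (a b c d : ℤ) → ℤ
det₂ a b c d = a ℤ.* d ℤ.- b ℤ.* c

catalan : ℕ → ℚ
catalan n = (+ ((2 * n) C n)) / suc n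

{-# OPTIONS --safe #-}

-- Write B n k for M_{n,k}(0,0).  The adjacency operator of the half-line
-- (B (n+1) k = B n (k-1) + B n (k+1)) is symmetric, so Σ_h B a h · B b h only
-- depends on a + b and equals B (a+b) 0.  Since B n k vanishes for odd n + k,
-- the signed determinants are B n k · B (n+1) (k+1) + B n (k+1) · B (n+1) k, and
-- they sum to Σ_h B n h · B (n+2) h = B (2n+2) 0 = C_{n+1}.  The reflection
-- principle gives B (2i+h) h = binom(2i+h, i) - binom(2i+h, i-1), which turns
-- Σ_h B a h · B b h for (a,b) = (2m+1, 2m+1) and (2m+1, 2m+3) into the two
-- binomial sums.
module Submission where

open import Defs
open import Data.Fin.Base using (toℕ; fromℕ; inject₁)
open import Data.Fin.Properties using (toℕ-inject₁; toℕ-fromℕ)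
open import Data.Integer.Base as ℤ using (ℤ; +_; 0ℤ; 1ℤ; -1ℤ)
import Data.Integer.Properties as ℤ
import Data.Integer.Tactic.RingSolver as ℤSolver
open import Data.List.Base using (List; []; _∷_; _++_; map; foldr)
open import Data.Nat.Base using (ℕ; zero; suc; _+_; _*_; _∸_; _^_; _≤_; _<_; z≤n; s≤s; s≤s⁻¹; NonZero)
open import Data.Nat.Combinatorics using (_C_; k>n⇒nCk≡0; nCk≡nC[n∸k]; nCk+nC[k+1]≡[n+1]C[k+1])
open import Data.Nat.Properties hiding (+-0-commutativeMonoid)
open import Data.Nat.Tactic.RingSolver using (solve-∀)
open import Data.Product.Base using (_×_; _,_)
open import Data.Rational.Base as ℚ using (ℚ; _/_; toℚᵘ)
open import Data.Rational.Properties using (+-0-commutativeMonoid; fromℚᵘ-cong; toℚᵘ-fromℚᵘ; toℚᵘ-injective; toℚᵘ-homo-*; toℚᵘ-homo-+)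
open import Data.Rational.Unnormalised.Base as ℚᵘ using (mkℚᵘ; *≡*)
import Data.Rational.Unnormalised.Properties as ℚᵘ
open import Algebra.Properties.CommutativeMonoid.Sum +-0-commutativeMonoid using (sum; sum⁺-syntax; sum-cong-≗; sum-init-last)
open import Function.Base using (_∘_)
open import Relation.Binary.PropositionalEquality

-- Finite sums of natural numbers.

∑< : ℕ → (ℕ → ℕ) → ℕ
∑< zero    f = 0
∑< (suc n) f = ∑< n f + f n

∑<-odd : ∀ f → (∀ j → f (2 * j) ≡ 0) → ∀ n → ∑< (2 * n) f ≡ ∑< n (λ j → f (1 + 2 * j))
∑<-odd f even≡0 zero    = refl
∑<-odd f even≡0 (suc n) = begin
  ∑< (2 * suc n) f                       ≡⟨ cong (λ m → ∑< m f) (*-suc 2 n) ⟩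
  ∑< (2 * n) f + f (2 * n) + f (1 + 2 * n)
    ≡⟨ cong (_+ f (1 + 2 * n)) (trans (cong (λ z → ∑< (2 * n) f + z) (even≡0 n)) (+-identityʳ _)) ⟩
  ∑< (2 * n) f + f (1 + 2 * n)           ≡⟨ cong (_+ f (1 + 2 * n)) (∑<-odd f even≡0 n) ⟩
  ∑< (suc n) (λ j → f (1 + 2 * j))       ∎
  where open ≡-Reasoning

-- Ballot numbers and their convolution.

-- The B of the overview, taken in ℕ: with horizontal steps of weight 0 only paths of up and down
-- steps remain, and each of them counts 1.
ballot : ℕ → ℕ → ℕ
ballot zero    zero    = 1
ballot zero    (suc k) = 0
ballot (suc n) zero    = ballot n 1
ballot (suc n) (suc k) = ballot n k + ballot n (2 + k)

ballot-vanish : ∀ {n k} → n < k → ballot n k ≡ 0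
ballot-vanish {zero}  {suc k} _   = refl
ballot-vanish {suc n} {suc k} n<k =
  cong₂ _+_ (ballot-vanish (s≤s⁻¹ n<k)) (ballot-vanish (m≤n⇒m≤1+n (m≤n⇒m≤1+n (s≤s⁻¹ n<k))))

-- Summation by parts, as in the Christoffel–Darboux formula, with the boundary
-- terms moved so that no subtraction occurs.
ballot-adjoint : ∀ a b K →
  ∑< (suc K) (λ h → ballot (suc a) h * ballot b h) + ballot a K * ballot b (suc K) ≡
  ∑< (suc K) (λ h → ballot a h * ballot (suc b) h) + ballot a (suc K) * ballot b K
ballot-adjoint a b zero = eq (ballot a 1) (ballot b 0) (ballot a 0) (ballot b 1)
  where
  eq : ∀ a₁ b₀ a₀ b₁ → a₁ * b₀ + a₀ * b₁ ≡ a₀ * b₁ + a₁ * b₀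
  eq = solve-∀
ballot-adjoint a b (suc K) =
  trans (lhs (S (suc a) b) a₀ a₁ a₂ b₁ b₂)
    (trans (cong (_+ (a₂ * b₁ + a₁ * b₂)) (ballot-adjoint a b K))
      (rhs (S a (suc b)) a₁ a₂ b₀ b₁ b₂))
  where
  S : ℕ → ℕ → ℕ
  S a b = ∑< (suc K) (λ h → ballot a h * ballot b h)
  a₀ = ballot a K
  a₁ = ballot a (1 + K)
  a₂ = ballot a (2 + K)
  b₀ = ballot b K
  b₁ = ballot b (1 + K)
  b₂ = ballot b (2 + K)
  lhs : ∀ s a₀ a₁ a₂ b₁ b₂ →
        s + (a₀ + a₂) * b₁ + a₁ * b₂ ≡ (s + a₀ * b₁) + (a₂ * b₁ + a₁ * b₂)
  lhs = solve-∀
  rhs : ∀ s a₁ a₂ b₀ b₁ b₂ →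
        (s + a₁ * b₀) + (a₂ * b₁ + a₁ * b₂) ≡ s + a₁ * (b₀ + b₂) + a₂ * b₁
  rhs = solve-∀

-- Both boundary terms of `ballot-adjoint` contain `ballot a` at height K or K + 1, which a steps
-- cannot reach.
ballot-shift : ∀ {a b K} → a < K →
  ∑< (suc K) (λ h → ballot (suc a) h * ballot b h) ≡
  ∑< (suc K) (λ h → ballot a h * ballot (suc b) h)
ballot-shift {a} {b} {K} a<K = begin
  L                                  ≡⟨ +-identityʳ L ⟨
  L + 0                              ≡⟨ cong (λ z → L + z * ballot b (suc K)) (ballot-vanish a<K) ⟨
  L + ballot a K * ballot b (suc K)  ≡⟨ ballot-adjoint a b K ⟩
  R + ballot a (suc K) * ballot b K  ≡⟨ cong (λ z → R + z * ballot b K) (ballot-vanish (m≤n⇒m≤1+n a<K)) ⟩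
  R + 0                              ≡⟨ +-identityʳ R ⟩
  R                                  ∎
  where
  open ≡-Reasoning
  L = ∑< (suc K) (λ h → ballot (suc a) h * ballot b h)
  R = ∑< (suc K) (λ h → ballot a h * ballot (suc b) h)

-- Steps move one at a time from the first factor to the second until a = 0, where only height 0
-- contributes. Combinatorially, a path back to the axis is cut after a steps and its second part is
-- reversed.
ballot-convolution : ∀ a b {K} → a ≤ K →
  ∑< (suc K) (λ h → ballot a h * ballot b h) ≡ ballot (a + b) 0
ballot-convolution zero    b {zero}  _   = +-identityʳ (ballot b 0)
ballot-convolution zero    b {suc K} _   =
  trans (+-identityʳ _) (ballot-convolution zero b {K} z≤n)
ballot-convolution (suc a) b {K}     a<K = begin
  ∑< (suc K) (λ h → ballot (suc a) h * ballot b h) ≡⟨ ballot-shift {b = b} a<K ⟩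
  ∑< (suc K) (λ h → ballot a h * ballot (suc b) h) ≡⟨ ballot-convolution a (suc b) (<⇒≤ a<K) ⟩
  ballot (a + suc b) 0                             ≡⟨ cong (λ n → ballot n 0) (+-suc a b) ⟩
  ballot (suc a + b) 0                             ∎
  where open ≡-Reasoning

-- Expanding `ballot (2 + n) h` by its last step and shifting the index in the half that comes from
-- h - 1 yields the products on the left. The shifted half stops one term early, which leaves the
-- boundary product.
ballot-cross-sum : ∀ n K →
  ∑< (suc K) (λ k → ballot n k * ballot (suc n) (suc k) + ballot n (suc k) * ballot (suc n) k) ≡
  ∑< (suc K) (λ h → ballot n h * ballot (2 + n) h) + ballot n (suc K) * ballot (suc n) K
ballot-cross-sum n zero = refl
ballot-cross-sum n (suc K) = trans
  (cong (_+ (ballot n (1 + K) * ballot (suc n) (2 + K) + ballot n (2 + K) * ballot (suc n) (1 + K)))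
    (ballot-cross-sum n K))
  (eq (∑< (suc K) (λ h → ballot n h * ballot (2 + n) h)) (ballot n (1 + K)) (ballot n (2 + K))
      (ballot (suc n) K) (ballot (suc n) (1 + K)) (ballot (suc n) (2 + K)))
  where
  eq : ∀ s a₁ a₂ b₀ b₁ b₂ →
       s + a₁ * b₀ + (a₁ * b₂ + a₂ * b₁) ≡ s + a₁ * (b₀ + b₂) + a₂ * b₁
  eq = solve-∀

-- Binomial coefficients.

infixl 6.5 _C⁻_

-- Stands for binom(n, k - 1). Truncated subtraction would give 1 at k = 0, where Pascal's rule and
-- the reflection principle need 0.
_C⁻_ : ℕ → ℕ → ℕ
n C⁻ zero  = 0
n C⁻ suc k = n C k

pascal : ∀ n k → n C⁻ k + n C k ≡ suc n C k
pascal n zero    = refl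
pascal n (suc k) = nCk+nC[k+1]≡[n+1]C[k+1] n k

-- Induction on n: Pascal's rule splits the left side, the hypothesis applies at k + 1 and at k, and
-- Pascal's rule recombines the result.
absorption : ∀ n k → k * (suc n C k) ≡ suc n * (n C⁻ k)
absorption n zero = sym (*-zeroʳ (suc n))
absorption zero (suc zero) = refl
absorption zero (suc (suc k)) =
  trans (cong (suc (suc k) *_) (k>n⇒nCk≡0 {1} {suc (suc k)} (s≤s (s≤s z≤n)))) (trans (*-zeroʳ (suc (suc k)))
    (sym (cong (1 *_) (k>n⇒nCk≡0 {0} {suc k} (s≤s z≤n)))))
absorption (suc n) (suc k) = begin
  suc k * (suc (suc n) C suc k)           ≡⟨ cong (suc k *_) (pascal (suc n) (suc k)) ⟨
  suc k * (c + suc n C suc k)             ≡⟨ *-distribˡ-+ (suc k) c _ ⟩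
  suc k * c + suc k * (suc n C suc k)     ≡⟨ cong (λ z → suc k * c + z) (absorption n (suc k)) ⟩
  c + k * c + suc n * (n C k)             ≡⟨ cong (λ z → c + z + suc n * (n C k)) (absorption n k) ⟩
  c + suc n * (n C⁻ k) + suc n * (n C k)  ≡⟨ eq c (suc n) (n C⁻ k) (n C k) ⟩
  c + suc n * (n C⁻ k + n C k)            ≡⟨ cong (λ z → c + suc n * z) (pascal n k) ⟩
  suc (suc n) * c                         ∎
  where
  open ≡-Reasoning
  c = suc n C k
  eq : ∀ c s x y → c + s * x + s * y ≡ c + s * (x + y)
  eq = solve-∀

-- The complement of `absorption` inside (n + 1) binom(n + 1, k). The argument l is n + 1 - k,
-- passed separately to avoid truncated subtraction.
coabsorption : ∀ n k l → k + l ≡ suc n → suc n * (n C k) ≡ l * (suc n C k)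
coabsorption n k l k+l≡1+n = +-cancelˡ-≡ (k * (suc n C k)) _ _ (begin
  k * (suc n C k) + suc n * (n C k)      ≡⟨ cong (_+ suc n * (n C k)) (absorption n k) ⟩
  suc n * (n C⁻ k) + suc n * (n C k)     ≡⟨ *-distribˡ-+ (suc n) (n C⁻ k) (n C k) ⟨
  suc n * (n C⁻ k + n C k)               ≡⟨ cong (suc n *_) (pascal n k) ⟩
  suc n * (suc n C k)                    ≡⟨ cong (_* (suc n C k)) k+l≡1+n ⟨
  (k + l) * (suc n C k)                  ≡⟨ *-distribʳ-+ (suc n C k) k l ⟩
  k * (suc n C k) + l * (suc n C k)      ∎)
  where open ≡-Reasoning

C⁻-ratio : ∀ n k l → k + l ≡ suc n → l * (n C⁻ k) ≡ k * (n C k)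
C⁻-ratio n k l k+l≡1+n = +-cancelˡ-≡ (k * (n C⁻ k)) _ _ (begin
  k * (n C⁻ k) + l * (n C⁻ k)  ≡⟨ *-distribʳ-+ (n C⁻ k) k l ⟨
  (k + l) * (n C⁻ k)           ≡⟨ cong (_* (n C⁻ k)) k+l≡1+n ⟩
  suc n * (n C⁻ k)             ≡⟨ absorption n k ⟨
  k * (suc n C k)              ≡⟨ cong (k *_) (pascal n k) ⟨
  k * (n C⁻ k + n C k)         ≡⟨ *-distribˡ-+ k (n C⁻ k) (n C k) ⟩
  k * (n C⁻ k) + k * (n C k)   ∎)
  where open ≡-Reasoning

-- Needed for paths that end on the axis in the reflection principle.
central-symmetry : ∀ n i → n ≡ 2 * i + 1 → n C i ≡ n C suc i
central-symmetry n i n≡ = trans (nCk≡nC[n∸k] i≤n) (cong (n C_) n∸i≡1+i)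
  where
  n≡′ : n ≡ i + suc i
  n≡′ = trans n≡ (eq i)
    where
    eq : ∀ i → 2 * i + 1 ≡ i + suc i
    eq = solve-∀
  i≤n : i ≤ n
  i≤n = subst (i ≤_) (sym n≡′) (m≤m+n i (suc i))
  n∸i≡1+i : n ∸ i ≡ suc i
  n∸i≡1+i = trans (cong (_∸ i) n≡′) (m+n∸m≡n i (suc i))

-- Reflection principle and closed forms.

-- Here i counts down steps. Among all binom(n, i) unrestricted paths, those that touch height -1
-- become, after reflecting their start, paths from -2 to h with i - 1 down steps. The proof checks
-- that both sides obey the same recurrence.
ballot-reflection : ∀ n i h → n ≡ 2 * i + h → ballot n h + n C⁻ i ≡ n C i
ballot-reflection zero    zero    zero    _ = refl
ballot-reflection (suc n) zero    (suc h) n≡ = begin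
  ballot n h + ballot n (2 + h) + 0
    -- Without down steps n = h, so height h + 2 is out of reach.
    ≡⟨ cong (λ z → ballot n h + z + 0) (ballot-vanish (s≤s (≤-trans (≤-reflexive (suc-injective n≡)) (n≤1+n h)))) ⟩
  ballot n h + 0 + 0  ≡⟨ +-identityʳ _ ⟩
  ballot n h + 0      ≡⟨ ballot-reflection n zero h (suc-injective n≡) ⟩
  n C 0               ≡⟨ pascal n 0 ⟩
  suc n C 0           ∎
  where open ≡-Reasoning
ballot-reflection (suc n) (suc i) zero n≡ = begin
  ballot n 1 + suc n C i             ≡⟨ cong (λ z → ballot n 1 + z) (pascal n i) ⟨
  ballot n 1 + (n C⁻ i + n C i)      ≡⟨ +-assoc (ballot n 1) _ _ ⟨
  -- No path arrives from height -1. The formula agrees, since the two middle binomials of the odd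
  -- number n cancel there.
  ballot n 1 + n C⁻ i + n C i        ≡⟨ cong₂ _+_ (ballot-reflection n i 1 n≡′) (central-symmetry n i n≡′) ⟩
  n C i + n C suc i                  ≡⟨ pascal n (suc i) ⟩
  suc n C suc i                      ∎
  where
  open ≡-Reasoning
  eq : ∀ i → 2 * suc i + 0 ≡ suc (2 * i + 1)
  eq = solve-∀
  n≡′ : n ≡ 2 * i + 1
  n≡′ = suc-injective (trans n≡ (eq i))
ballot-reflection (suc n) (suc i) (suc h) n≡ = begin
  ballot n h + ballot n (2 + h) + suc n C i
    ≡⟨ cong (λ z → ballot n h + ballot n (2 + h) + z) (pascal n i) ⟨
  ballot n h + ballot n (2 + h) + (n C⁻ i + n C i)
    ≡⟨ eq (ballot n h) (ballot n (2 + h)) (n C⁻ i) (n C i) ⟩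
  (ballot n (2 + h) + n C⁻ i) + (ballot n h + n C i)
    ≡⟨ cong₂ _+_ (ballot-reflection n i (2 + h) (suc-injective (trans n≡ (eq₂ i h))))
                 (ballot-reflection n (suc i) h (suc-injective (trans n≡ (+-suc (2 * suc i) h)))) ⟩
  n C i + n C suc i  ≡⟨ pascal n (suc i) ⟩
  suc n C suc i      ∎
  where
  open ≡-Reasoning
  eq : ∀ a b c d → a + b + (c + d) ≡ (b + c) + (a + d)
  eq = solve-∀
  eq₂ : ∀ i h → 2 * suc i + suc h ≡ suc (2 * i + (2 + h))
  eq₂ = solve-∀

-- The factor `i + suc h` is n + 1 - i. Multiplying the reflection identity by it turns binom(n, i -
-- 1) into a multiple of binom(n, i) through `C⁻-ratio`, leaving n + 1 - 2i = h + 1.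
ballot-formula : ∀ n i h → n ≡ 2 * i + h → (i + suc h) * ballot n h ≡ suc h * (n C i)
ballot-formula n i h n≡ = +-cancelˡ-≡ (i * (n C i)) _ _ (begin
  i * (n C i) + (i + suc h) * ballot n h
    ≡⟨ cong (_+ (i + suc h) * ballot n h) (C⁻-ratio n i (i + suc h) (trans (eq i h) (cong suc (sym n≡)))) ⟨
  (i + suc h) * (n C⁻ i) + (i + suc h) * ballot n h
    ≡⟨ eq₂ (i + suc h) (n C⁻ i) (ballot n h) ⟩
  (i + suc h) * (ballot n h + n C⁻ i)  ≡⟨ cong ((i + suc h) *_) (ballot-reflection n i h n≡) ⟩
  (i + suc h) * (n C i)                ≡⟨ *-distribʳ-+ (n C i) i (suc h) ⟩
  i * (n C i) + suc h * (n C i)        ∎)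
  where
  open ≡-Reasoning
  eq : ∀ i h → i + (i + suc h) ≡ suc (2 * i + h)
  eq = solve-∀
  eq₂ : ∀ s x y → s * x + s * y ≡ s * (y + x)
  eq₂ = solve-∀

-- `coabsorption` trades the denominator n + 1 - i for n + 1, which does not depend on the height
-- and so is common to all terms of a sum.
ballot-formula⁺ : ∀ n i h → n ≡ 2 * i + h → suc n * ballot n h ≡ suc h * (suc n C i)
ballot-formula⁺ n i h n≡ = *-cancelˡ-≡ _ _ (suc (i + h)) (begin
  suc (i + h) * (suc n * ballot n h)   ≡⟨ swap (suc (i + h)) (suc n) (ballot n h) ⟩
  suc n * (suc (i + h) * ballot n h)
    ≡⟨ cong (suc n *_) (trans (cong (_* ballot n h) (sym (+-suc i h))) (ballot-formula n i h n≡)) ⟩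
  suc n * (suc h * (n C i))            ≡⟨ swap (suc n) (suc h) (n C i) ⟩
  suc h * (suc n * (n C i))
    ≡⟨ cong (suc h *_) (coabsorption n i (suc (i + h)) (trans (eq i h) (cong suc (sym n≡)))) ⟩
  suc h * (suc (i + h) * (suc n C i))  ≡⟨ swap (suc h) (suc (i + h)) (suc n C i) ⟩
  suc (i + h) * (suc h * (suc n C i))  ∎)
  where
  open ≡-Reasoning
  eq : ∀ i h → i + suc (i + h) ≡ suc (2 * i + h)
  eq = solve-∀
  swap : ∀ a b c → a * (b * c) ≡ b * (a * c)
  swap = solve-∀

-- Identifies m - j as the number of down steps at length 2m + 1 and height 2j + 1.
parity : ∀ {m j} → j ≤ m → 1 + 2 * m ≡ 2 * (m ∸ j) + (1 + 2 * j)
parity {m} {j} j≤m = trans (cong (λ m → 1 + 2 * m) (sym (m∸n+n≡m j≤m))) (eq (m ∸ j) j)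
  where
  eq : ∀ i j → 1 + 2 * (i + j) ≡ 2 * i + (1 + 2 * j)
  eq = solve-∀

ballot-square : ∀ {m j} → j ≤ m →
  (2 + 2 * j) ^ 2 * ((2 + 2 * m) C (m ∸ j)) ^ 2 ≡
  (ballot (1 + 2 * m) (1 + 2 * j) * ballot (1 + 2 * m) (1 + 2 * j)) * (2 + 2 * m) ^ 2
ballot-square {m} {j} j≤m = begin
  u ^ 2 * c ^ 2      ≡⟨ square u c ⟩
  (u * c) * (u * c)  ≡⟨ cong₂ _*_ formula formula ⟨
  (v * b) * (v * b)  ≡⟨ regroup v b ⟩
  (b * b) * v ^ 2    ∎
  where
  open ≡-Reasoning
  u = 2 + 2 * j
  v = 2 + 2 * m
  c = (2 + 2 * m) C (m ∸ j)
  b = ballot (1 + 2 * m) (1 + 2 * j)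
  formula : v * b ≡ u * c
  formula = ballot-formula⁺ (1 + 2 * m) (m ∸ j) (1 + 2 * j) (parity j≤m)
  -- `u * (u * 1)` is what `u ^ 2` unfolds to.
  square : ∀ u c → u * (u * 1) * (c * (c * 1)) ≡ (u * c) * (u * c)
  square = solve-∀
  regroup : ∀ v b → (v * b) * (v * b) ≡ (b * b) * (v * (v * 1))
  regroup = solve-∀

-- The factor 2m + 2 clears the denominator of the shorter ballot number. The factor 2m + 3 raises
-- its binomial to upper index 2m + 3 and releases l, exactly the denominator of the longer one.
ballot-product : ∀ {m j} → j ≤ m →
  (2 + 2 * j) ^ 2 * ((3 + 2 * m) C (m ∸ j)) * ((3 + 2 * m) C (m ∸ j + 1)) ≡
  (ballot (1 + 2 * m) (1 + 2 * j) * ballot (3 + 2 * m) (1 + 2 * j)) * ((2 + 2 * m) * (3 + 2 * m))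
ballot-product {m} {j} j≤m = sym (begin
  (b * b′) * (v * w)     ≡⟨ regroup₁ b b′ v w ⟩
  (v * b) * (w * b′)     ≡⟨ cong (_* (w * b′)) (ballot-formula⁺ (1 + 2 * m) i h (parity j≤m)) ⟩
  (u * c₀) * (w * b′)    ≡⟨ regroup₂ u c₀ w b′ ⟩
  u * ((w * c₀) * b′)    ≡⟨ cong (λ z → u * (z * b′)) (coabsorption (2 + 2 * m) i (i + 1 + suc h) w≡) ⟩
  u * ((l * c) * b′)     ≡⟨ regroup₃ u l c b′ ⟩
  (u * c) * (l * b′)     ≡⟨ cong ((u * c) *_) (ballot-formula (3 + 2 * m) (i + 1) h n≡) ⟩
  (u * c) * (u * c′)     ≡⟨ regroup₄ u c c′ ⟩
  u ^ 2 * c * c′         ∎)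
  where
  open ≡-Reasoning
  i = m ∸ j
  h = 1 + 2 * j
  l = i + 1 + suc h
  u = 2 + 2 * j
  v = 2 + 2 * m
  w = 3 + 2 * m
  b = ballot (1 + 2 * m) (1 + 2 * j)
  b′ = ballot (3 + 2 * m) (1 + 2 * j)
  c₀ = (2 + 2 * m) C i
  c = (3 + 2 * m) C i
  c′ = (3 + 2 * m) C (i + 1)
  w≡ : i + (i + 1 + suc h) ≡ 3 + 2 * m
  w≡ = trans (eq i h) (cong (λ z → 2 + z) (sym (parity j≤m)))
    where
    eq : ∀ i h → i + (i + 1 + suc h) ≡ 2 + (2 * i + h)
    eq = solve-∀
  n≡ : 3 + 2 * m ≡ 2 * (i + 1) + h
  n≡ = trans (cong (λ z → 2 + z) (parity j≤m)) (eq i h)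
    where
    eq : ∀ i h → 2 + (2 * i + h) ≡ 2 * (i + 1) + h
    eq = solve-∀
  regroup₁ : ∀ b b′ v w → (b * b′) * (v * w) ≡ (v * b) * (w * b′)
  regroup₁ = solve-∀
  regroup₂ : ∀ u c₀ w b′ → (u * c₀) * (w * b′) ≡ u * ((w * c₀) * b′)
  regroup₂ = solve-∀
  regroup₃ : ∀ u l c b′ → u * ((l * c) * b′) ≡ (u * c) * (l * b′)
  regroup₃ = solve-∀
  regroup₄ : ∀ u c c′ → (u * c) * (u * c′) ≡ u * (u * 1) * c * c′
  regroup₄ = solve-∀

-- From fractions to natural numbers.

fromℕ/ : ∀ n d .{{_ : NonZero d}} → toℚᵘ ((+ n) / d) ℚᵘ.≃ (+ n) ℚᵘ./ d
fromℕ/ n (suc d) = toℚᵘ-fromℚᵘ (mkℚᵘ (+ n) d)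

-- Every summand of the binomial sums is a natural number, so the rational identities reduce to
-- identities in ℕ.
/-exact : ∀ {p q r} .{{_ : NonZero q}} → p ≡ r * q → (+ p) / q ≡ (+ r) / 1
/-exact {p} {suc q} {r} p≡rq =
  fromℚᵘ-cong {mkℚᵘ (+ p) q} {mkℚᵘ (+ r) 0} (*≡* (trans (ℤ.*-identityʳ (+ p)) (trans (cong +_ p≡rq) (ℤ.pos-* r (suc q)))))

-- `_/_` normalises by a gcd; on unnormalised rationals the equation is plain cross multiplication.
/-+-homo : ∀ a b → (+ a) / 1 ℚ.+ (+ b) / 1 ≡ (+ (a + b)) / 1
/-+-homo a b = toℚᵘ-injective
  (ℚᵘ.≃-trans (toℚᵘ-homo-+ ((+ a) / 1) ((+ b) / 1))
  (ℚᵘ.≃-trans (ℚᵘ.+-cong (fromℕ/ a 1) (fromℕ/ b 1))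
  (ℚᵘ.≃-trans (*≡* (cong (ℤ._* + 1) (cong₂ ℤ._+_ (ℤ.*-identityʳ (+ a)) (ℤ.*-identityʳ (+ b)))))
  (ℚᵘ.≃-sym (fromℕ/ (a + b) 1)))))

/-*-homo : ∀ a b d .{{_ : NonZero d}} → (+ a) / d ℚ.* ((+ b) / 1) ≡ (+ (a * b)) / d
/-*-homo a b d@(suc _) = toℚᵘ-injective
  (ℚᵘ.≃-trans (toℚᵘ-homo-* ((+ a) / d) ((+ b) / 1))
  (ℚᵘ.≃-trans (ℚᵘ.*-cong (fromℕ/ a d) (fromℕ/ b 1))
  (ℚᵘ.≃-trans (*≡* (cong₂ ℤ._*_ (sym (ℤ.pos-* a b)) (cong +_ (sym (*-identityʳ d)))))
  (ℚᵘ.≃-sym (fromℕ/ (a * b) d)))))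

-- `sum` splits off its first term and `∑<` its last, hence `sum-init-last`. The bound k < n is what
-- later supplies k ≤ n or j ≤ m to the termwise identities.
sum-fromℕ : ∀ n (f : ℕ → ℚ) g → (∀ {k} → k < n → f k ≡ (+ g k) / 1) →
            sum {n} (f ∘ toℕ) ≡ (+ ∑< n g) / 1
sum-fromℕ zero    f g f≡g = refl
sum-fromℕ (suc n) f g f≡g = begin
  sum {suc n} (f ∘ toℕ)                              ≡⟨ sum-init-last {n} (f ∘ toℕ) ⟩
  sum {n} (f ∘ toℕ ∘ inject₁) ℚ.+ f (toℕ (fromℕ n))  ≡⟨ cong₂ ℚ._+_ (sum-cong-≗ {n} (λ i → cong f (toℕ-inject₁ i))) (cong f (toℕ-fromℕ n)) ⟩
  sum {n} (f ∘ toℕ) ℚ.+ f n                          ≡⟨ cong₂ ℚ._+_ (sum-fromℕ n f g (f≡g ∘ m≤n⇒m≤1+n)) (f≡g ≤-refl) ⟩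
  (+ ∑< n g) / 1 ℚ.+ (+ g n) / 1                     ≡⟨ /-+-homo (∑< n g) (g n) ⟩
  (+ ∑< (suc n) g) / 1                               ∎
  where open ≡-Reasoning

-- The closed form at height 0 with n down steps.
catalan≡ballot : ∀ n → catalan n ≡ (+ ballot (2 * n) 0) / 1
catalan≡ballot n = /-exact {r = ballot (2 * n) 0} (begin
  (2 * n) C n                 ≡⟨ +-identityʳ _ ⟨
  1 * ((2 * n) C n)           ≡⟨ ballot-formula (2 * n) n 0 (sym (+-identityʳ _)) ⟨
  (n + 1) * ballot (2 * n) 0  ≡⟨ cong (_* ballot (2 * n) 0) (+-comm n 1) ⟩
  suc n * ballot (2 * n) 0    ≡⟨ *-comm (suc n) _ ⟩
  ballot (2 * n) 0 * suc n    ∎)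
  where open ≡-Reasoning

-- Path weights at x = y = 0.

∑ℤ : ∀ {A : Set} → (A → ℤ) → List A → ℤ
∑ℤ f xs = foldr ℤ._+_ 0ℤ (map f xs)

∑ℤ-++ : ∀ {A : Set} (f : A → ℤ) xs ys → ∑ℤ f (xs ++ ys) ≡ ∑ℤ f xs ℤ.+ ∑ℤ f ys
∑ℤ-++ f []       ys = sym (ℤ.+-identityˡ _)
∑ℤ-++ f (x ∷ xs) ys = trans (cong (ℤ._+_ (f x)) (∑ℤ-++ f xs ys)) (sym (ℤ.+-assoc (f x) _ _))

-- Here s appends a last step and c is its weight; this gives the recurrences of `M` by last step.
∑ℤ-map : ∀ {A B : Set} (f : A → ℤ) (g : B → ℤ) (s : A → B) c →
         (∀ x → g (s x) ≡ f x ℤ.* c) → ∀ xs → ∑ℤ g (map s xs) ≡ ∑ℤ f xs ℤ.* c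
∑ℤ-map f g s c gs≡fc []       = refl
∑ℤ-map f g s c gs≡fc (x ∷ xs) =
  trans (cong₂ ℤ._+_ (gs≡fc x) (∑ℤ-map f g s c gs≡fc xs)) (sym (ℤ.*-distribʳ-+ c (f x) _))

M-zero : ∀ x y n → M (suc n) 0 x y ≡ M n 0 x y ℤ.* x ℤ.+ M n 1 x y ℤ.* 1ℤ
M-zero x y n = trans (∑ℤ-++ (weight x y) (map _▷H (paths n 0)) _)
  (cong₂ ℤ._+_ (∑ℤ-map _ _ _▷H x (λ _ → refl) (paths n 0))
               (∑ℤ-map _ _ _▷D 1ℤ (λ _ → refl) (paths n 1)))

M-suc : ∀ x y n k → M (suc n) (suc k) x y ≡
        M n k x y ℤ.* 1ℤ ℤ.+ (M n (suc k) x y ℤ.* y ℤ.+ M n (2 + k) x y ℤ.* 1ℤ)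
M-suc x y n k = trans (∑ℤ-++ (weight x y) (map _▷U (paths n k)) _)
  (cong₂ ℤ._+_ (∑ℤ-map _ _ _▷U 1ℤ (λ _ → refl) (paths n k))
    (trans (∑ℤ-++ (weight x y) (map _▷H (paths n (suc k))) _)
      (cong₂ ℤ._+_ (∑ℤ-map _ _ _▷H y (λ _ → refl) (paths n (suc k)))
                   (∑ℤ-map _ _ _▷D 1ℤ (λ _ → refl) (paths n (2 + k))))))

M≡ballot : ∀ n k → M n k 0ℤ 0ℤ ≡ + ballot n k
M≡ballot zero    zero    = refl
M≡ballot zero    (suc k) = refl
M≡ballot (suc n) zero    = trans (M-zero 0ℤ 0ℤ n)
  (trans (eq (M n 0 0ℤ 0ℤ) (M n 1 0ℤ 0ℤ)) (M≡ballot n 1))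
  where
  eq : ∀ a b → a ℤ.* 0ℤ ℤ.+ b ℤ.* 1ℤ ≡ b
  eq = ℤSolver.solve-∀
M≡ballot (suc n) (suc k) = trans (M-suc 0ℤ 0ℤ n k)
  (trans (eq (M n k 0ℤ 0ℤ) (M n (1 + k) 0ℤ 0ℤ) (M n (2 + k) 0ℤ 0ℤ))
    (cong₂ ℤ._+_ (M≡ballot n k) (M≡ballot n (2 + k))))
  where
  eq : ∀ a b c → a ℤ.* 1ℤ ℤ.+ (b ℤ.* 0ℤ ℤ.+ c ℤ.* 1ℤ) ≡ a ℤ.+ c
  eq = ℤSolver.solve-∀

-- Signs and parity.

-- Encodes the vanishing for odd n + k as an equation, so that no case split on parity is needed.
ballot-sign : ∀ n k → -1ℤ ℤ.^ (n + k) ℤ.* + ballot n k ≡ + ballot n k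
ballot-sign zero    zero    = refl
ballot-sign zero    (suc k) = ℤ.*-zeroʳ (-1ℤ ℤ.^ suc k)
ballot-sign (suc n) zero    =
  subst (λ e → -1ℤ ℤ.^ e ℤ.* + ballot n 1 ≡ + ballot n 1) (+-suc n 0) (ballot-sign n 1)
ballot-sign (suc n) (suc k) = trans
  (ℤ.*-distribˡ-+ (-1ℤ ℤ.^ (suc n + suc k)) (+ ballot n k) (+ ballot n (2 + k)))
  (cong₂ ℤ._+_ up down)
  where
  eq : ∀ s a → -1ℤ ℤ.* (-1ℤ ℤ.* s) ℤ.* a ≡ s ℤ.* a
  eq = ℤSolver.solve-∀
  -- An up step adds 2 to n + k, so two signs cancel; a down step leaves n + k unchanged.
  up : -1ℤ ℤ.^ (suc n + suc k) ℤ.* + ballot n k ≡ + ballot n k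
  up = trans (cong (λ e → -1ℤ ℤ.^ suc e ℤ.* + ballot n k) (+-suc n k))
    (trans (eq (-1ℤ ℤ.^ (n + k)) (+ ballot n k)) (ballot-sign n k))
  down : -1ℤ ℤ.^ (suc n + suc k) ℤ.* + ballot n (2 + k) ≡ + ballot n (2 + k)
  down = subst (λ e → -1ℤ ℤ.^ e ℤ.* + ballot n (2 + k) ≡ + ballot n (2 + k))
    (+-suc n (suc k)) (ballot-sign n (2 + k))

sign-∸ : ∀ {n k} → k ≤ n → -1ℤ ℤ.^ (n ∸ k) ≡ -1ℤ ℤ.^ (n + k)
sign-∸ {n} {k} k≤n = sym (begin
  -1ℤ ℤ.^ (n + k)                     ≡⟨ cong (λ e → -1ℤ ℤ.^ (e + k)) (m∸n+n≡m k≤n) ⟨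
  -1ℤ ℤ.^ (n ∸ k + k + k)             ≡⟨ cong (-1ℤ ℤ.^_) (eq (n ∸ k) k) ⟩
  -1ℤ ℤ.^ (n ∸ k + 2 * k)             ≡⟨ ℤ.^-distribˡ-+-* -1ℤ (n ∸ k) (2 * k) ⟩
  -1ℤ ℤ.^ (n ∸ k) ℤ.* -1ℤ ℤ.^ (2 * k)  ≡⟨ cong (-1ℤ ℤ.^ (n ∸ k) ℤ.*_) (ℤ.^-*-assoc -1ℤ 2 k) ⟨
  -1ℤ ℤ.^ (n ∸ k) ℤ.* 1ℤ ℤ.^ k         ≡⟨ cong (-1ℤ ℤ.^ (n ∸ k) ℤ.*_) (ℤ.^-zeroˡ k) ⟩
  -1ℤ ℤ.^ (n ∸ k) ℤ.* 1ℤ               ≡⟨ ℤ.*-identityʳ _ ⟩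
  -1ℤ ℤ.^ (n ∸ k)                     ∎)
  where
  open ≡-Reasoning
  eq : ∀ d k → d + k + k ≡ d + 2 * k
  eq = solve-∀

-- The sign is absorbed by `ballot n k` in the first product. In the second, the minus of the
-- determinant makes it the sign belonging to `ballot n (suc k)`, which absorbs it as well.
signed-det : ∀ {n k} → k ≤ n →
  -1ℤ ℤ.^ (n ∸ k) ℤ.*
    det₂ (M n k 0ℤ 0ℤ)       (M n (suc k) 0ℤ 0ℤ)
         (M (suc n) k 0ℤ 0ℤ) (M (suc n) (suc k) 0ℤ 0ℤ) ≡
  + (ballot n k * ballot (suc n) (suc k) + ballot n (suc k) * ballot (suc n) k)
signed-det {n} {k} k≤n
  rewrite M≡ballot n k | M≡ballot n (suc k) | M≡ballot (suc n) k | M≡ballot (suc n) (suc k)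
        | sign-∸ k≤n = begin
  s ℤ.* det₂ a b c d                              ≡⟨ expand s a b c d ⟩
  (s ℤ.* a) ℤ.* d ℤ.+ (-1ℤ ℤ.* s ℤ.* b) ℤ.* c
    ≡⟨ cong₂ (λ x y → x ℤ.* d ℤ.+ y ℤ.* c) (ballot-sign n k)
         (trans (cong (λ e → -1ℤ ℤ.^ e ℤ.* b) (sym (+-suc n k))) (ballot-sign n (suc k))) ⟩
  a ℤ.* d ℤ.+ b ℤ.* c                             ≡⟨ cong₂ ℤ._+_ (ℤ.pos-* (ballot n k) _) (ℤ.pos-* (ballot n (suc k)) _) ⟨
  + (ballot n k * ballot (suc n) (suc k) + ballot n (suc k) * ballot (suc n) k) ∎
  where
  open ≡-Reasoning
  s = -1ℤ ℤ.^ (n + k)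
  a = + ballot n k
  b = + ballot n (suc k)
  c = + ballot (suc n) k
  d = + ballot (suc n) (suc k)
  expand : ∀ s a b c d → s ℤ.* (a ℤ.* d ℤ.- b ℤ.* c) ≡ (s ℤ.* a) ℤ.* d ℤ.+ (-1ℤ ℤ.* s ℤ.* b) ℤ.* c
  expand = ℤSolver.solve-∀

ballot-odd-even : ∀ m j → ballot (1 + 2 * m) (2 * j) ≡ 0
ballot-odd-even m j = self-negative (begin
  -1ℤ ℤ.* b                            ≡⟨ cong (λ s → -1ℤ ℤ.* s ℤ.* b) (ℤ.^-zeroˡ (m + j)) ⟨
  -1ℤ ℤ.* 1ℤ ℤ.^ (m + j) ℤ.* b         ≡⟨ cong (λ s → -1ℤ ℤ.* s ℤ.* b) (ℤ.^-*-assoc -1ℤ 2 (m + j)) ⟩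
  -1ℤ ℤ.^ (1 + 2 * (m + j)) ℤ.* b      ≡⟨ cong (λ e → -1ℤ ℤ.^ suc e ℤ.* b) (*-distribˡ-+ 2 m j) ⟩
  -1ℤ ℤ.^ (1 + 2 * m + 2 * j) ℤ.* b    ≡⟨ ballot-sign (1 + 2 * m) (2 * j) ⟩
  b                                    ∎)
  where
  open ≡-Reasoning
  b = + ballot (1 + 2 * m) (2 * j)
  self-negative : ∀ {n} → -1ℤ ℤ.* + n ≡ + n → n ≡ 0
  -- For a successor the hypothesis equates a negative with a positive integer, so that case is
  -- absurd.
  self-negative {zero} _ = refl

-- The three identities.

odd-convolution : ∀ m b →
  ballot (1 + 2 * m + b) 0 ≡ ∑< (suc m) (λ j → ballot (1 + 2 * m) (1 + 2 * j) * ballot b (1 + 2 * j))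
odd-convolution m b = begin
  -- The cutoff K = 2m + 1 gives 2(m + 1) heights, which pair up as even and odd.
  ballot (1 + 2 * m + b) 0         ≡⟨ ballot-convolution (1 + 2 * m) b ≤-refl ⟨
  ∑< (2 + 2 * m) f                 ≡⟨ cong (λ n → ∑< n f) (*-suc 2 m) ⟨
  ∑< (2 * suc m) f                 ≡⟨ ∑<-odd f (λ j → cong (_* ballot b (2 * j)) (ballot-odd-even m j)) (suc m) ⟩
  ∑< (suc m) (λ j → f (1 + 2 * j)) ∎
  where
  open ≡-Reasoning
  f : ℕ → ℕ
  f h = ballot (1 + 2 * m) h * ballot b h

double-suc : ∀ n → 2 * suc n ≡ n + (2 + n)
double-suc = solve-∀

determinant-sum : ∀ n →
  sum {suc n} (λ i → (-1ℤ ℤ.^ (n ∸ toℕ i) ℤ.*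
    det₂ (M n (toℕ i) 0ℤ 0ℤ)       (M n (suc (toℕ i)) 0ℤ 0ℤ)
         (M (suc n) (toℕ i) 0ℤ 0ℤ) (M (suc n) (suc (toℕ i)) 0ℤ 0ℤ)) / 1)
  ≡ catalan (suc n)
determinant-sum n = begin
  sum {suc n} (term ∘ toℕ)          ≡⟨ sum-fromℕ (suc n) term cross (λ k<1+n → cong (_/ 1) (signed-det (s≤s⁻¹ k<1+n))) ⟩
  (+ ∑< (suc n) cross) / 1          ≡⟨ cong (λ z → (+ z) / 1) cross-sum ⟩
  (+ ballot (2 * suc n) 0) / 1      ≡⟨ catalan≡ballot (suc n) ⟨
  catalan (suc n)                   ∎
  where
  open ≡-Reasoning
  term : ℕ → ℚ
  term k = (-1ℤ ℤ.^ (n ∸ k) ℤ.*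
    det₂ (M n k 0ℤ 0ℤ)       (M n (suc k) 0ℤ 0ℤ)
         (M (suc n) k 0ℤ 0ℤ) (M (suc n) (suc k) 0ℤ 0ℤ)) / 1
  cross product : ℕ → ℕ
  cross k = ballot n k * ballot (suc n) (suc k) + ballot n (suc k) * ballot (suc n) k
  product h = ballot n h * ballot (2 + n) h
  cross-sum : ∑< (suc n) cross ≡ ballot (2 * suc n) 0
  cross-sum = begin
    ∑< (suc n) cross                                             ≡⟨ ballot-cross-sum n n ⟩
    ∑< (suc n) product + ballot n (suc n) * ballot (suc n) n
      -- The boundary term vanishes: n steps cannot reach height n + 1.
      ≡⟨ cong (λ z → ∑< (suc n) product + z * ballot (suc n) n) (ballot-vanish {n} ≤-refl) ⟩
    ∑< (suc n) product + 0                                       ≡⟨ +-identityʳ _ ⟩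
    ∑< (suc n) product                                           ≡⟨ ballot-convolution n (2 + n) ≤-refl ⟩
    ballot (n + (2 + n)) 0                                       ≡⟨ cong (λ e → ballot e 0) (double-suc n) ⟨
    ballot (2 * suc n) 0                                         ∎

odd-catalan : ∀ m →
  catalan (1 + 2 * m) ≡
  sum {suc m} (λ i → (+ ((2 + 2 * toℕ i) ^ 2)) / ((2 + 2 * m) ^ 2)
    ℚ.* ((+ (((2 + 2 * m) C (m ∸ toℕ i)) ^ 2)) / 1))
odd-catalan m = begin
  catalan n                        ≡⟨ catalan≡ballot n ⟩
  (+ ballot (2 * n) 0) / 1         ≡⟨ cong (λ e → (+ ballot (n + e) 0) / 1) (+-identityʳ n) ⟩
  (+ ballot (n + n) 0) / 1         ≡⟨ cong (λ z → (+ z) / 1) (odd-convolution m n) ⟩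
  (+ ∑< (suc m) square) / 1        ≡⟨ sum-fromℕ (suc m) term square term≡ ⟨
  sum {suc m} (term ∘ toℕ)         ∎
  where
  open ≡-Reasoning
  n = 1 + 2 * m
  term : ℕ → ℚ
  term j = (+ ((2 + 2 * j) ^ 2)) / ((2 + 2 * m) ^ 2)
    ℚ.* ((+ (((2 + 2 * m) C (m ∸ j)) ^ 2)) / 1)
  square : ℕ → ℕ
  square j = ballot n (1 + 2 * j) * ballot n (1 + 2 * j)
  term≡ : ∀ {j} → j < suc m → term j ≡ (+ square j) / 1
  term≡ {j} j<1+m = trans
    (/-*-homo ((2 + 2 * j) ^ 2) (((2 + 2 * m) C (m ∸ j)) ^ 2) ((2 + 2 * m) ^ 2))
    (/-exact {r = square j} (ballot-square (s≤s⁻¹ j<1+m)))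

-- The length 4m + 4 is cut as (2m + 1) + (2m + 3) rather than in the middle, so both parts are odd
-- and the heights are again 2j + 1.
even-catalan : ∀ m →
  catalan (2 + 2 * m) ≡
  sum {suc m} (λ i → (+ ((2 + 2 * toℕ i) ^ 2)) / ((2 + 2 * m) * (3 + 2 * m))
    ℚ.* ((+ ((3 + 2 * m) C (m ∸ toℕ i))) / 1)
    ℚ.* ((+ ((3 + 2 * m) C (m ∸ toℕ i + 1))) / 1))
even-catalan m = begin
  catalan (suc n)                     ≡⟨ catalan≡ballot (suc n) ⟩
  (+ ballot (2 * suc n) 0) / 1        ≡⟨ cong (λ e → (+ ballot e 0) / 1) (double-suc n) ⟩
  (+ ballot (n + (2 + n)) 0) / 1      ≡⟨ cong (λ z → (+ z) / 1) (odd-convolution m (2 + n)) ⟩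
  (+ ∑< (suc m) product) / 1          ≡⟨ sum-fromℕ (suc m) term product term≡ ⟨
  sum {suc m} (term ∘ toℕ)            ∎
  where
  open ≡-Reasoning
  n = 1 + 2 * m
  d = (2 + 2 * m) * (3 + 2 * m)
  u c c′ : ℕ → ℕ
  u j = (2 + 2 * j) ^ 2
  c j = (3 + 2 * m) C (m ∸ j)
  c′ j = (3 + 2 * m) C (m ∸ j + 1)
  term : ℕ → ℚ
  term j = (+ u j) / d ℚ.* ((+ c j) / 1) ℚ.* ((+ c′ j) / 1)
  product : ℕ → ℕ
  product j = ballot n (1 + 2 * j) * ballot (2 + n) (1 + 2 * j)
  term≡ : ∀ {j} → j < suc m → term j ≡ (+ product j) / 1
  term≡ {j} j<1+m = begin
    (+ u j) / d ℚ.* ((+ c j) / 1) ℚ.* ((+ c′ j) / 1)  ≡⟨ cong (λ q → q ℚ.* ((+ c′ j) / 1)) (/-*-homo (u j) (c j) d) ⟩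
    (+ (u j * c j)) / d ℚ.* ((+ c′ j) / 1)            ≡⟨ /-*-homo (u j * c j) (c′ j) d ⟩
    (+ (u j * c j * c′ j)) / d                        ≡⟨ /-exact {r = product j} (ballot-product (s≤s⁻¹ j<1+m)) ⟩
    (+ product j) / 1                                 ∎

theorem4p1 : (∀ (n : ℕ) →
    (∑[ i ≤ n ] (let k = toℕ i in
    (-1ℤ ℤ.^ (n ∸ k) ℤ.*
    det₂ (M n k 0ℤ 0ℤ)       (M n (suc k) 0ℤ 0ℤ)
    (M (suc n) k 0ℤ 0ℤ) (M (suc n) (suc k) 0ℤ 0ℤ)) / 1))
    ≡ catalan (suc n))
    × (∀ (m : ℕ) →
    catalan (1 + 2 * m) ≡
    (∑[ i ≤ m ] (let j = toℕ i in
    (+ ((2 + 2 * j) ^ 2)) / ((2 + 2 * m) ^ 2)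
    ℚ.* ((+ (((2 + 2 * m) C (m ∸ j)) ^ 2)) / 1))))
    × (∀ (m : ℕ) →
    catalan (2 + 2 * m) ≡
    (∑[ i ≤ m ] (let j = toℕ i in
    (+ ((2 + 2 * j) ^ 2)) / ((2 + 2 * m) * (3 + 2 * m))
    ℚ.* ((+ ((3 + 2 * m) C (m ∸ j))) / 1)
    ℚ.* ((+ ((3 + 2 * m) C (m ∸ j + 1))) / 1))))
theorem4p1 = determinant-sum , odd-catalan , even-catalan
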